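{- Let $m\geq 3$ and $k\geq 4$ be integers, and let $F(m,k)$ be the $(m,k)$-firecracker tree. Then $$hc(F(m,k))=\begin{cases} m^2k^2-6m(k-1)-\frac{k}{2}(m^2-1)+2, & \text{if } m \text{ is odd},\\[4pt] m^2k^2-6m(k-1)-\frac{k}{2}m^2+2, & \text{if } m \text{ is even}.\end{cases}$$
   Context: For a connected graph $G$ of order $n$ (finite, simple), $D(u,v)$ denotes the detour distance between vertices $u,v$, i.e. the length of a longest $u,v$-path in $G$ (for a tree this is the ordinary distance). A hamiltonian coloring of $G$ is a map $c: V(G)\to\{0,1,2,\dots\}$ such that $D(u,v)+|c(u)-c(v)|\geq n-1$ for every two distinct vertices $u,v$. The value $hc(c)$ is the maximum color assigned by $c$, and the hamiltonian chromatic number $hc(G)$ is the minimum of $hc(c)$ over all hamiltonian colorings $c$ of $G$ (note that the color $0$ is allowed). A $k$-star is a tree consisting of $k$ leaves and another vertex joined to all leaves by edges. The $(m,k)$-firecracker tree $F(m,k)$ is the tree obtained by taking $m$ copies of a $(k-1)$-star and identifying a leaf of each of them with a different vertex of a path of length $m-1$ (a path on $m$ vertices); it has $mk$ vertices. -}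

module Defs where

open import Data.Nat using (ℕ; zero; suc; _+_; _*_; _∸_; _≤_; ∣_-_∣)
open import Data.Nat.Properties using (∸-monoˡ-≤; 1+n≢n)
open import Data.Fin using (Fin; zero; suc; toℕ; fromℕ<)
open import Data.Fin.Properties using (*↔×)
open import Data.List using (List; []; _∷_)
open import Data.List.Relation.Unary.Unique.Propositional using (Unique)
open import Data.Product using (Σ-syntax; ∃-syntax; _×_; _,_)
open import Data.Product.Function.NonDependent.Propositional using (_×-↔_)
open import Data.Sum using (_⊎_; inj₁; inj₂; swap)
open import Function.Bundles using (_↔_)
open import Function.Construct.Composition using (_↔-∘_)
open import Function.Construct.Identity using (↔-id)
open import Function.Construct.Symmetry using (↔-sym)
open import Relation.Binary.Construct.Closure.ReflexiveTransitive
  using (Star; ε; _◅_; _◅◅_; gmap; reverse)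
open import Relation.Binary.Definitions using (Symmetric)
open import Relation.Binary.PropositionalEquality using (_≡_; _≢_; refl; sym; cong)
open import Relation.Nullary using (¬_)

record ConnectedGraph : Set₁ where
  field
    Vertex    : Set
    order     : ℕ
    finite    : Vertex ↔ Fin order
    Adj       : Vertex → Vertex → Set
    symmetric : Symmetric Adj
    loopless  : ∀ {v} → ¬ Adj v v
    connected : ∀ u v → Star Adj u v

module _ (G : ConnectedGraph) where
  open ConnectedGraph G

  Walk : Vertex → Vertex → Set
  Walk = Star Adj

  vertices : ∀ {u v} → Walk u v → List Vertex
  vertices {u} ε       = u ∷ []
  vertices {u} (_ ◅ w) = u ∷ vertices w

  length : ∀ {u v} → Walk u v → ℕ
  length ε       = 0
  length (_ ◅ w) = suc (length w)

  IsPath : ∀ {u v} → Walk u v → Set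
  IsPath w = Unique (vertices w)

  IsDetourDistance : Vertex → Vertex → ℕ → Set
  IsDetourDistance u v d =
    (Σ[ p ∈ Walk u v ] IsPath p × length p ≡ d) ×
    (∀ (p : Walk u v) → IsPath p → length p ≤ d)

  Coloring : Set
  Coloring = Vertex → ℕ

  IsHamiltonian : Coloring → Set
  IsHamiltonian c = ∀ u v → u ≢ v →
    ∃[ d ] IsDetourDistance u v d × order ∸ 1 ≤ d + ∣ c u - c v ∣

  IsMaxColor : Coloring → ℕ → Set
  IsMaxColor c h = (∃[ v ] c v ≡ h) × (∀ v → c v ≤ h)

  IsHamiltonianChromaticNumber : ℕ → Set
  IsHamiltonianChromaticNumber h =
    (∃[ c ] IsHamiltonian c × IsMaxColor c h) ×
    (∀ c h′ → IsHamiltonian c → IsMaxColor c h′ → h ≤ h′)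

pathGraph : ℕ → ConnectedGraph
pathGraph n = record
  { Vertex    = Fin n
  ; order     = n
  ; finite    = ↔-id (Fin n)
  ; Adj       = Next
  ; symmetric = swap
  ; loopless  = λ { (inj₁ e) → 1+n≢n (sym e) ; (inj₂ e) → 1+n≢n (sym e) }
  ; connected = connect
  }
  where
  Next : ∀ {n} → Fin n → Fin n → Set
  Next i j = toℕ i ≡ suc (toℕ j) ⊎ toℕ j ≡ suc (toℕ i)

  shift : ∀ {n} {i j : Fin n} → Next i j → Next (suc i) (suc j)
  shift (inj₁ e) = inj₁ (cong suc e)
  shift (inj₂ e) = inj₂ (cong suc e)

  fromZero : ∀ {n} (i : Fin (suc n)) → Star Next zero i
  fromZero         zero    = ε
  fromZero {suc n} (suc i) = inj₂ refl ◅ gmap suc shift (fromZero i)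

  connect : ∀ {n} (i j : Fin n) → Star Next i j
  connect {suc n} i j = reverse swap (fromZero i) ◅◅ fromZero j

-- Vertex zero is the centre; the k vertices suc i are the leaves.
data StarAdj {k : ℕ} : Fin (suc k) → Fin (suc k) → Set where
  centre-leaf : ∀ {i} → StarAdj zero (suc i)
  leaf-centre : ∀ {i} → StarAdj (suc i) zero

starGraph : ℕ → ConnectedGraph
starGraph k = record
  { Vertex    = Fin (suc k)
  ; order     = suc k
  ; finite    = ↔-id (Fin (suc k))
  ; Adj       = StarAdj
  ; symmetric = λ { centre-leaf → leaf-centre ; leaf-centre → centre-leaf }
  ; loopless  = λ ()
  ; connected = λ u v → toCentre u ◅◅ fromCentre v
  }
  where
  toCentre : ∀ u → Star StarAdj u zero
  toCentre zero    = ε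
  toCentre (suc _) = leaf-centre ◅ ε

  fromCentre : ∀ v → Star StarAdj zero v
  fromCentre zero    = ε
  fromCentre (suc _) = centre-leaf ◅ ε

-- One copy of H for each vertex a of G, with the vertex r of that copy
-- identified with a: the pair (a , x) is the vertex x of the copy at a, and
-- (a , r) is at the same time the vertex a of G.
attachCopies : (G H : ConnectedGraph) → ConnectedGraph.Vertex H → ConnectedGraph
attachCopies G H r = record
  { Vertex    = G.Vertex × H.Vertex
  ; order     = G.order * H.order
  ; finite    = ↔-sym *↔× ↔-∘ (G.finite ×-↔ H.finite)
  ; Adj       = Adj
  ; symmetric = λ { (inj₁ (p , q , e)) → inj₁ (q , p , G.symmetric e)
                  ; (inj₂ (p , e))     → inj₂ (sym p , H.symmetric e) }
  ; loopless  = λ { (inj₁ (_ , _ , e)) → G.loopless e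
                  ; (inj₂ (_ , e))     → H.loopless e }
  ; connected = λ { (a , x) (b , y) →
      inCopy a (H.connected x r) ◅◅ alongG (G.connected a b)
        ◅◅ inCopy b (H.connected r y) }
  }
  where
  module G = ConnectedGraph G
  module H = ConnectedGraph H

  Adj : G.Vertex × H.Vertex → G.Vertex × H.Vertex → Set
  Adj (a , x) (b , y) = (x ≡ r × y ≡ r × G.Adj a b) ⊎ (a ≡ b × H.Adj x y)

  inCopy : ∀ a {x y} → Star H.Adj x y → Star Adj (a , x) (a , y)
  inCopy a = gmap (a ,_) (λ e → inj₂ (refl , e))

  alongG : ∀ {a b} → Star G.Adj a b → Star Adj (a , r) (b , r)
  alongG = gmap (_, r) (λ e → inj₁ (refl , refl , e))

-- The bound 2 ≤ k ensures that the (k ∸ 1)-star has a leaf.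
firecracker : (m k : ℕ) → 2 ≤ k → ConnectedGraph
firecracker m k 2≤k = attachCopies (pathGraph m) (starGraph (k ∸ 1)) leaf
  where
  leaf : Fin (suc (k ∸ 1))
  leaf = suc (fromℕ< (∸-monoˡ-≤ 1 2≤k))

-- Let L v be the distance from v to the nearest weight centre, and e + 1 the
-- number of weight centres. Detours in a tree are its unique paths, so
-- D(u,v) ≤ L u + L v + e; summing over the vertices in the order of their colours
-- bounds the largest colour from below by
--   (n - 1)(n - 1 - e) + (L first + L last) - 2 Σ L.
-- Equality holds for a tour of the vertices in which consecutive vertices lie on
-- opposite sides of the centre and L first + L last = 1 - e, coloured with the gaps
-- n - 1 - D. Two consecutive gaps already sum to at least n - 2, because
-- L ≤ (m - 1)/2 + 2, so vertices that are not consecutive are never in conflict.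

module Submission where

open import Data.Nat as ℕ using (ℕ; zero; suc; _∸_; _≤_; _<_; z≤n; s≤s; ∣_-_∣)
open import Data.Nat.Properties
open import Data.Nat.Divisibility using (_∣_; divides; ∣1⇒≡1; ∣m+n∣m⇒∣n)
open import Data.Nat.DivMod using (m*n/n≡m)
open import Data.Nat.ListAction using (sum)
open import Data.Nat.ListAction.Properties using (sum-↭; sum-++)
import Data.Nat.Tactic.RingSolver as ℕSolver
import Data.Integer.Properties as ℤ
import Data.Integer.Tactic.RingSolver as ℤSolver
open import Data.Fin using (Fin; zero; suc; toℕ; fromℕ; inject₁)
import Data.Fin.Properties as Fin
open import Data.Fin.Relation.Unary.Top using (view; ‵fromℕ; ‵inject₁)
open import Data.List as List using (List; []; _∷_; map; _++_; cartesianProductWith; allFin)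
open import Data.List.Properties
  using (length-map; length-++; length-tabulate; map-++; map-∘; map-cong; ++-identityʳ; ++-assoc)
open import Data.List.Membership.Propositional using (_∈_)
open import Data.List.Membership.Propositional.Properties
  using (∈-map⁺; ∈-map⁻; ∈-++⁺ˡ; ∈-++⁺ʳ; ∈-allFin; ∈-cartesianProductWith⁺)
open import Data.List.Relation.Unary.All as All using (All; []; _∷_)
open import Data.List.Relation.Unary.Any using (here; there)
open import Data.List.Relation.Unary.AllPairs using ([]; _∷_)
open import Data.List.Relation.Unary.Linked using (Linked; _∷_)
open import Data.List.Relation.Unary.Unique.Propositional using (Unique)
import Data.List.Relation.Unary.Unique.Propositional.Properties as Unique
open import Data.List.Relation.Binary.Permutation.Propositional using (_↭_; ↭-sym; ↭⇒↭ₛ)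
import Data.List.Relation.Binary.Permutation.Propositional.Properties as Perm
import Data.List.Relation.Binary.Permutation.Setoid.Properties as PermS
import Data.List.Sort as Sort
open import Data.Product using (_×_; _,_; proj₁; proj₂; Σ-syntax; ∃-syntax; ∃₂)
open import Data.Sum as Sum using (_⊎_; inj₁; inj₂)
open import Data.Unit using (⊤; tt)
open import Data.Empty using (⊥-elim)
open import Function using (_∘_; id)
import Relation.Binary.Construct.On as On
open import Relation.Binary.PropositionalEquality
open import Relation.Nullary using (¬_; yes; no)
open import Defs


-- A detour distance quantifies over all paths, which are awkward to handle in a graph glued from
-- copies. `IsTreeMetric` asks only for local facts about a candidate distance: it changes by one
-- along each edge, and at most one neighbour is closer to a given target. These facts pass from the
-- path and the star to the glued graph, and they force every path to descend towards its end, so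
-- its length is determined. The tour treats the two coordinates of a vertex separately. Vertices in
-- different copies on opposite sides are at extremal distance whatever their places in the stars,
-- so it suffices to order the copies once, in a zigzag, and to repeat that order for each star
-- vertex. For this the zigzag must close up to a cycle: it starts at a weight centre and ends at
-- the left end of the path, which lies opposite. The cycle also allows the tour to start one vertex
-- later, which gives its ends the required levels. The smallest case leaves no room: for m = 3 and
-- k = 4 the lower bound for two consecutive gaps is exactly n - 2.

-- Detour distances in trees

module TreeDistances where
  open import Data.Nat using (_+_)
  open import Relation.Binary.Construct.Closure.ReflexiveTransitive using (ε; _◅_)

  -- All conditions concern a single vertex, an edge or two edges at one vertex, so they can be
  -- checked edge by edge in a glued graph; acyclicity is hidden in the uniqueness of the closer
  -- neighbour.
  record IsTreeMetric (G : ConnectedGraph)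
      (δ : ConnectedGraph.Vertex G → ConnectedGraph.Vertex G → ℕ) : Set where
    open ConnectedGraph G
    field
      δ-refl : ∀ v → δ v v ≡ 0
      δ≡0⇒≡  : ∀ u v → δ u v ≡ 0 → u ≡ v
      step   : ∀ {u u′} → Adj u u′ → ∀ v → δ u v ≡ suc (δ u′ v) ⊎ δ u′ v ≡ suc (δ u v)
      unique : ∀ {u u₁ u₂} → Adj u u₁ → Adj u u₂ → ∀ v →
               δ u v ≡ suc (δ u₁ v) → δ u v ≡ suc (δ u₂ v) → u₁ ≡ u₂

  module TreeMetric {G δ} (tree : IsTreeMetric G δ) where
    open ConnectedGraph G
    open IsTreeMetric tree

    Descending : ∀ {u v} → Walk G u v → Set
    Descending ε = ⊤
    Descending {u} {v} (_◅_ {j = u′} _ w) = δ u v ≡ suc (δ u′ v) × Descending w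

    length-descending : ∀ {u v} (w : Walk G u v) → Descending w → length G w ≡ δ u v
    length-descending {u} ε       _       = sym (δ-refl u)
    length-descending     (_ ◅ w) (p , d) = trans (cong suc (length-descending w d)) (sym p)

    vertices-descending : ∀ {u v} (w : Walk G u v) → Descending w →
                          All (λ z → δ z v ≤ δ u v) (vertices G w)
    vertices-descending ε       _       = ≤-refl ∷ []
    vertices-descending (_ ◅ w) (p , d) = ≤-refl ∷
      All.map (λ q → ≤-trans q (≤-trans (n≤1+n _) (≤-reflexive (sym p))))
              (vertices-descending w d)

    -- The start of a nonempty descending walk is strictly farther from `v` than every later vertex,
    -- so it cannot recur.
    descending⇒path : ∀ {u v} (w : Walk G u v) → Descending w → IsPath G w
    descending⇒path ε       _       = [] ∷ []
    descending⇒path (_ ◅ w) (p , d) =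
      All.map (λ { q refl → 1+n≰n (≤-trans (≤-reflexive (sym p)) q) }) (vertices-descending w d)
      ∷ descending⇒path w d

    head-vertex : ∀ {p} {P : Vertex → Set p} {u v} (w : Walk G u v) → All P (vertices G w) → P u
    head-vertex ε       (p ∷ _) = p
    head-vertex (_ ◅ _) (p ∷ _) = p

    -- After a step away from v, every closer neighbour is the vertex just left.
    no-retreat : ∀ {u u′ v} (e : Adj u u′) (w : Walk G u′ v) →
                 δ u′ v ≡ suc (δ u v) → ¬ IsPath G (e ◅ w)
    no-retreat {v = v} e ε eq _ = 0≢1+n (trans (sym (δ-refl v)) eq)
    no-retreat {v = v} e (f ◅ w) eq ((_ ∷ u∉w) ∷ pw) with step f v
    ... | inj₁ eq′ = head-vertex w u∉w (unique (symmetric e) f v eq eq′)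
    ... | inj₂ eq′ = no-retreat f w eq′ pw

    path⇒descending : ∀ {u v} (w : Walk G u v) → IsPath G w → Descending w
    path⇒descending ε _ = tt
    path⇒descending {v = v} (e ◅ w) pw@(_ ∷ pw′) with step e v
    ... | inj₁ eq = eq , path⇒descending w pw′
    ... | inj₂ eq = ⊥-elim (no-retreat e w eq pw)

    -- Backtracking is cancelled: after a step from `u` away from `v`, the straightened rest must
    -- begin with the only closer neighbour, which is `u` again, and both steps are dropped.
    straighten : ∀ {u v} → Walk G u v → Σ[ w ∈ Walk G u v ] Descending w
    straighten ε = ε , tt
    straighten {v = v} (e ◅ w) with step e v | straighten w
    ... | inj₁ eq | w′ , d = e ◅ w′ , eq , d
    ... | inj₂ eq | ε , _ = ⊥-elim (0≢1+n (trans (sym (δ-refl v)) eq))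
    ... | inj₂ eq | f ◅ w′ , eq′ , d with refl ← unique (symmetric e) f v eq eq′ = w′ , d

    isDetourDistance : ∀ u v → IsDetourDistance G u v (δ u v)
    isDetourDistance u v with straighten (connected u v)
    ... | w , d = (w , descending⇒path w d , length-descending w d)
                , λ p path → ≤-reflexive (length-descending p (path⇒descending p path))

    detourDistance-unique : ∀ {u v d} → IsDetourDistance G u v d → d ≡ δ u v
    detourDistance-unique ((p , path , eq) , _) =
      trans (sym eq) (length-descending p (path⇒descending p path))

  ∣-∣-step : ∀ i j → ∣ i - j ∣ ≡ suc ∣ suc i - j ∣ ⊎ ∣ suc i - j ∣ ≡ suc ∣ i - j ∣
  ∣-∣-step i       zero    = inj₂ (cong suc (sym (∣-∣-identityʳ i)))
  ∣-∣-step zero    (suc j) = inj₁ refl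
  ∣-∣-step (suc i) (suc j) = ∣-∣-step i j

  ∣-∣-step-unique : ∀ i j → ∣ suc i - j ∣ ≡ suc ∣ i - j ∣ → ∣ suc i - j ∣ ≢ suc ∣ suc (suc i) - j ∣
  ∣-∣-step-unique i       zero          p q = m≢1+m+n _ {1} (trans q (cong suc (+-comm 1 (suc i))))
  ∣-∣-step-unique zero    (suc j)       p q = m≢1+m+n j {1} (trans p (cong suc (+-comm 1 j)))
  ∣-∣-step-unique (suc i) (suc j)       p q = ∣-∣-step-unique i j p q

  path-tree : ∀ n → IsTreeMetric (pathGraph n) (λ i j → ∣ toℕ i - toℕ j ∣)
  path-tree n = record
    { δ-refl = λ v → ∣n-n∣≡0 (toℕ v)
    ; δ≡0⇒≡  = λ _ _ eq → Fin.toℕ-injective (∣m-n∣≡0⇒m≡n eq)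
    ; step   = step
    ; unique = unique
    }
    where
    open ConnectedGraph (pathGraph n)

    step : ∀ {u u′} → Adj u u′ → ∀ v →
           ∣ toℕ u - toℕ v ∣ ≡ suc ∣ toℕ u′ - toℕ v ∣ ⊎ ∣ toℕ u′ - toℕ v ∣ ≡ suc ∣ toℕ u - toℕ v ∣
    step {u} {u′} (inj₁ e) v rewrite e = Sum.swap (∣-∣-step (toℕ u′) (toℕ v))
    step {u} {u′} (inj₂ e) v rewrite e = ∣-∣-step (toℕ u) (toℕ v)

    unique : ∀ {u u₁ u₂} → Adj u u₁ → Adj u u₂ → ∀ v →
             ∣ toℕ u - toℕ v ∣ ≡ suc ∣ toℕ u₁ - toℕ v ∣ →
             ∣ toℕ u - toℕ v ∣ ≡ suc ∣ toℕ u₂ - toℕ v ∣ → u₁ ≡ u₂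
    unique (inj₁ e) (inj₁ e′) v _ _ = Fin.toℕ-injective (suc-injective (trans (sym e) e′))
    unique (inj₂ e) (inj₂ e′) v _ _ = Fin.toℕ-injective (trans e (sym e′))
    unique {u} {u₁} (inj₁ e) (inj₂ e′) v p q rewrite e′ | e =
      ⊥-elim (∣-∣-step-unique (toℕ u₁) (toℕ v) p q)
    unique {u} {u₁} {u₂} (inj₂ e) (inj₁ e′) v p q rewrite e | e′ =
      ⊥-elim (∣-∣-step-unique (toℕ u₂) (toℕ v) q p)

  starDistance : ∀ {k} → Fin (suc k) → Fin (suc k) → ℕ
  starDistance zero    zero    = 0
  starDistance zero    (suc _) = 1
  starDistance (suc _) zero    = 1
  starDistance (suc i) (suc j) with i Fin.≟ j
  ... | yes _ = 0
  ... | no  _ = 2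

  star-tree : ∀ k → IsTreeMetric (starGraph k) starDistance
  star-tree k = record
    { δ-refl = δ-refl
    ; δ≡0⇒≡  = δ≡0⇒≡
    ; step   = step
    ; unique = unique
    }
    where
    open ConnectedGraph (starGraph k)

    δ-refl : ∀ v → starDistance v v ≡ 0
    δ-refl zero = refl
    δ-refl (suc i) with i Fin.≟ i
    ... | yes _  = refl
    ... | no i≢i = ⊥-elim (i≢i refl)

    δ≡0⇒≡ : ∀ u v → starDistance u v ≡ 0 → u ≡ v
    δ≡0⇒≡ zero    zero    _ = refl
    δ≡0⇒≡ (suc i) (suc j) _ with i Fin.≟ j
    ... | yes refl = refl

    step : ∀ {u u′} → Adj u u′ → ∀ v →
           starDistance u v ≡ suc (starDistance u′ v) ⊎ starDistance u′ v ≡ suc (starDistance u v)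
    step centre-leaf zero = inj₂ refl
    step (centre-leaf {i}) (suc j) with i Fin.≟ j
    ... | yes _ = inj₁ refl
    ... | no  _ = inj₂ refl
    step leaf-centre zero = inj₁ refl
    step (leaf-centre {i}) (suc j) with i Fin.≟ j
    ... | yes _ = inj₂ refl
    ... | no  _ = inj₁ refl

    unique : ∀ {u u₁ u₂} → Adj u u₁ → Adj u u₂ → ∀ v →
             starDistance u v ≡ suc (starDistance u₁ v) →
             starDistance u v ≡ suc (starDistance u₂ v) → u₁ ≡ u₂
    unique leaf-centre leaf-centre _ _ _ = refl
    unique (centre-leaf {i}) (centre-leaf {i′}) (suc j) p q with i Fin.≟ j | i′ Fin.≟ j
    ... | yes refl | yes refl = refl

  module _ {G H : ConnectedGraph} (r : ConnectedGraph.Vertex H) {dG dH}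
           (treeG : IsTreeMetric G dG) (treeH : IsTreeMetric H dH) where
    private
      module G = ConnectedGraph G
      module H = ConnectedGraph H
      module TG = IsTreeMetric treeG
      module TH = IsTreeMetric treeH

    -- The first argument is the distance between the two copies.
    attachDistance : ℕ → H.Vertex → H.Vertex → ℕ
    attachDistance zero    x y = dH x y
    attachDistance (suc d) x y = dH x r + (suc d + dH r y)

    -- From a root, the distinction between equal and different copies disappears. Edges of `G` join
    -- roots, so their steps reduce to steps of `dG`.
    attachDistance-root : ∀ d y → attachDistance d r y ≡ d + dH r y
    attachDistance-root zero    y = refl
    attachDistance-root (suc d) y = cong (_+ (suc d + dH r y)) (TH.δ-refl r)

    attach-tree : IsTreeMetric (attachCopies G H r)
                    (λ u v → attachDistance (dG (proj₁ u) (proj₁ v)) (proj₂ u) (proj₂ v))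
    attach-tree = record
      { δ-refl = λ { (a , x) → trans (cong (λ d → attachDistance d x x) (TG.δ-refl a)) (TH.δ-refl x) }
      ; δ≡0⇒≡  = δ≡0⇒≡
      ; step   = step
      ; unique = unique
      }
      where
      open ConnectedGraph (attachCopies G H r)

      δ : Vertex → Vertex → ℕ
      δ u v = attachDistance (dG (proj₁ u) (proj₁ v)) (proj₂ u) (proj₂ v)

      δ≡0⇒≡ : ∀ u v → δ u v ≡ 0 → u ≡ v
      δ≡0⇒≡ (a , x) (b , y) eq with dG a b in eqG
      ... | zero  = cong₂ _,_ (TG.δ≡0⇒≡ a b eqG) (TH.δ≡0⇒≡ x y eq)
      ... | suc d = ⊥-elim (1+n≢0 (trans (sym (+-suc (dH x r) _)) eq))

      step : ∀ {u u′} → Adj u u′ → ∀ v → δ u v ≡ suc (δ u′ v) ⊎ δ u′ v ≡ suc (δ u v)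
      step {a , _} {a′ , _} (inj₁ (refl , refl , e)) (b , y)
        rewrite attachDistance-root (dG a b) y | attachDistance-root (dG a′ b) y =
        Sum.map (cong (_+ dH r y)) (cong (_+ dH r y)) (TG.step e b)
      step {a , _} (inj₂ (refl , f)) (b , y) with dG a b
      ... | zero  = TH.step f y
      ... | suc d = Sum.map (cong (_+ (suc d + dH r y))) (cong (_+ (suc d + dH r y))) (TH.step f r)

      closer : ∀ {a a′ b y} → δ (a , r) (b , y) ≡ suc (δ (a′ , r) (b , y)) → dG a b ≡ suc (dG a′ b)
      closer {a} {a′} {b} {y} p
        rewrite attachDistance-root (dG a b) y | attachDistance-root (dG a′ b) y =
        +-cancelʳ-≡ _ _ _ p

      -- A closer root in a neighbouring copy means that the target lies in another copy; the way
      -- there leaves through `r`, so no vertex of the present copy is closer than `r` itself.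
      mixed : ∀ {a a′ b x y} → δ (a , r) (b , y) ≡ suc (δ (a′ , r) (b , y)) →
              δ (a , r) (b , y) ≢ suc (δ (a , x) (b , y))
      mixed {a} {a′} {b} {x} {y} p q with dG a b | closer {a} {a′} {b} {y} p
      ... | suc d | _ = 0≢1+n (trans (sym (TH.δ-refl r))
                                     (+-cancelʳ-≡ (suc d + dH r y) (dH r r) (suc (dH x r)) q))

      unique : ∀ {u u₁ u₂} → Adj u u₁ → Adj u u₂ → ∀ v →
               δ u v ≡ suc (δ u₁ v) → δ u v ≡ suc (δ u₂ v) → u₁ ≡ u₂
      unique (inj₁ (refl , refl , e)) (inj₁ (_ , refl , e′)) (b , y) p q =
        cong (_, r) (TG.unique e e′ b (closer {y = y} p) (closer {y = y} q))
      unique (inj₁ (refl , refl , e)) (inj₂ (refl , f)) (b , y) p q = ⊥-elim (mixed {y = y} p q)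
      unique (inj₂ (refl , f)) (inj₁ (refl , refl , e)) (b , y) p q = ⊥-elim (mixed {y = y} q p)
      unique {a , _} (inj₂ (refl , f)) (inj₂ (refl , f′)) (b , y) p q with dG a b
      ... | zero  = cong (a ,_) (TH.unique f f′ y p q)
      ... | suc d = cong (a ,_) (TH.unique f f′ r (+-cancelʳ-≡ _ _ _ p) (+-cancelʳ-≡ _ _ _ q))

open TreeDistances

-- Lower bound and optimal colouring for a tree with levels

module Optimality where
  open import Data.Nat using (_+_; _*_)
  open import Data.Nat.Tactic.RingSolver using (solve-∀)


  -- Both ends are indices because concatenation needs them and because the levels of the two ends
  -- enter the value.
  data Chain {A : Set} (R : A → A → Set) : A → A → List A → Set where
    [_] : ∀ x → Chain R x x (x ∷ [])
    _∷_ : ∀ {x y z xs} → R x y → Chain R y z (y ∷ xs) → Chain R x z (x ∷ y ∷ xs)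

  infixr 5 _∷_

  -- `N` is n - 1 and `B` is n - 1 - `ε`, so an extremal pair needs colours that differ by `B` less
  -- its two levels. `κ` bounds the level sum of distinct vertices from below, `ℓ` bounds every
  -- level from above, and `N≤` says that two gaps of least possible size fall short of `N` by at
  -- most one.
  module Optimum {G δ} (tree : IsTreeMetric G δ) (δ-sym : ∀ u v → δ u v ≡ δ v u)
    (L : ConnectedGraph.Vertex G → ℕ) (ε κ ℓ B N : ℕ)
    (order≡ : ConnectedGraph.order G ∸ 1 ≡ N) (B+ε≡N : B + ε ≡ N)
    (δ≤ : ∀ u v → δ u v ≤ L u + L v + ε)
    (κ≤ : ∀ u v → u ≢ v → κ ≤ L u + L v)
    (L≤ℓ : ∀ v → L v ≤ ℓ)
    (ℓ+ℓ≤B : ℓ + ℓ ≤ B)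
    (N≤ : N ≤ suc ((B ∸ (ℓ + ℓ)) + (B ∸ (ℓ + ℓ))))
    (1≤N : 1 ≤ N)
    where
    open ConnectedGraph G using (Vertex)
    open IsTreeMetric tree
    open TreeMetric tree

    levels : List Vertex → ℕ
    levels xs = sum (map L xs)

    -- The inequality `B + c x ≤ c y + (L x + L y)` telescopes along the sorted list. Inner levels
    -- occur twice and the levels of the two ends once, which accounts for `L x + L z` on the left.
    -- The witness `z` is the last entry; that it differs from `x` is recorded for the later use of
    -- `κ≤`.
    sorted-bound : ∀ c → IsHamiltonian G c → ∀ x xs → Linked (λ u v → c u ≤ c v) (x ∷ xs) →
      Unique (x ∷ xs) → ∃[ z ] z ∈ x ∷ xs × (List.length xs ≡ 0 ⊎ x ≢ z) ×
        List.length xs * B + c x + (L x + L z) ≤ c z + (levels (x ∷ xs) + levels (x ∷ xs))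
    sorted-bound c ham x [] _ _ = x , here refl , inj₁ refl ,
      ≤-reflexive (cong (c x +_) (cong₂ _+_ (sym (+-identityʳ (L x))) (sym (+-identityʳ (L x)))))
    sorted-bound c ham x (y ∷ ys) (cx≤cy ∷ lk) (x∉ys@(x≢y ∷ _) ∷ uq)
      with sorted-bound c ham y ys lk uq | ham x y x≢y
    ... | z , z∈ , _ , ih | d , isD , N≤d+ = z , there z∈ , inj₂ (All.lookup x∉ys z∈) , bound
      where
      open ≤-Reasoning
      S = levels (y ∷ ys)
      K = List.length ys * B

      gap≤ : B + c x ≤ c y + (L x + L y)
      gap≤ = +-cancelʳ-≤ ε _ _ (begin
        B + c x + ε                          ≡⟨ regroup₁ B (c x) ε ⟩
        (B + ε) + c x                        ≡⟨ cong (_+ c x) (trans B+ε≡N (sym order≡)) ⟩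
        (ConnectedGraph.order G ∸ 1) + c x   ≤⟨ +-monoˡ-≤ (c x) N≤d+ ⟩
        d + ∣ c x - c y ∣ + c x              ≡⟨ cong₂ (λ a b → a + b + c x) (detourDistance-unique isD)
                                                  (m≤n⇒∣m-n∣≡n∸m cx≤cy) ⟩
        δ x y + (c y ∸ c x) + c x            ≡⟨ +-assoc (δ x y) _ _ ⟩
        δ x y + (c y ∸ c x + c x)            ≡⟨ cong (δ x y +_) (m∸n+n≡m cx≤cy) ⟩
        δ x y + c y                          ≤⟨ +-monoˡ-≤ (c y) (δ≤ x y) ⟩
        L x + L y + ε + c y                  ≡⟨ regroup₂ (L x) (L y) ε (c y) ⟩
        c y + (L x + L y) + ε                ∎)
        where
        regroup₁ : ∀ b c e → b + c + e ≡ b + e + c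
        regroup₁ = solve-∀
        regroup₂ : ∀ x y e c → x + y + e + c ≡ c + (x + y) + e
        regroup₂ = solve-∀

      bound : (B + K) + c x + (L x + L z) ≤ c z + ((L x + S) + (L x + S))
      bound = begin
        (B + K) + c x + (L x + L z)              ≡⟨ regroup₃ B K (c x) (L x) (L z) ⟩
        (B + c x) + (K + (L x + L z))            ≤⟨ +-monoˡ-≤ _ gap≤ ⟩
        c y + (L x + L y) + (K + (L x + L z))    ≡⟨ regroup₄ (c y) (L x) (L y) K (L z) ⟩
        (K + c y + (L y + L z)) + (L x + L x)    ≤⟨ +-monoˡ-≤ _ ih ⟩
        (c z + (S + S)) + (L x + L x)            ≡⟨ regroup₅ (c z) S (L x) ⟩
        c z + ((L x + S) + (L x + S))            ∎
        where
        regroup₃ : ∀ b k c x z → (b + k) + c + (x + z) ≡ (b + c) + (k + (x + z))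
        regroup₃ = solve-∀
        regroup₄ : ∀ c x y k z → c + (x + y) + (k + (x + z)) ≡ (k + c + (y + z)) + (x + x)
        regroup₄ = solve-∀
        regroup₅ : ∀ c s x → (c + (s + s)) + (x + x) ≡ c + ((x + s) + (x + s))
        regroup₅ = solve-∀

    sorted-lower-bound : ∀ c → IsHamiltonian G c → ∀ xs → Linked (λ u v → c u ≤ c v) xs →
      Unique xs → List.length xs ≡ suc N → ∃[ z ] N * B + κ ≤ c z + (levels xs + levels xs)
    sorted-lower-bound c ham (x ∷ xs) lk uq len with sorted-bound c ham x xs lk uq
    ... | z , _ , inj₁ eq , _ = ⊥-elim (<⇒≢ 1≤N (trans (sym eq) (suc-injective len)))
    ... | z , _ , inj₂ x≢z , bound = z , (begin
      N * B + κ                                  ≤⟨ +-mono-≤ (m≤m+n (N * B) (c x)) (κ≤ x z x≢z) ⟩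
      N * B + c x + (L x + L z)                  ≡⟨ cong (λ n → n * B + c x + (L x + L z)) (suc-injective len) ⟨
      List.length xs * B + c x + (L x + L z)     ≤⟨ bound ⟩
      c z + (levels (x ∷ xs) + levels (x ∷ xs))  ∎)
      where open ≤-Reasoning

    lower-bound : ∀ c → IsHamiltonian G c → ∀ xs → Unique xs → List.length xs ≡ suc N →
      ∃[ z ] N * B + κ ≤ c z + (levels xs + levels xs)
    lower-bound c ham xs uq len
      with sorted-lower-bound c ham (sort xs) (sort-↗ xs)
             (PermS.Unique-resp-↭ (setoid Vertex) (↭⇒↭ₛ (↭-sym (sort-↭ xs))) uq)
             (trans (Perm.↭-length (sort-↭ xs)) len)
      where open Sort (On.decTotalOrder ≤-decTotalOrder c)
    ... | z , bound = z , subst (λ S → N * B + κ ≤ c z + (S + S))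
                                (sum-↭ (Perm.map⁺ L (Sort.sort-↭ (On.decTotalOrder ≤-decTotalOrder c) xs))) bound

    -- For an extremal pair this is `N` less the distance. The truncated subtraction is exact
    -- because `ℓ + ℓ ≤ B`.
    gap : Vertex → Vertex → ℕ
    gap u v = B ∸ (L u + L v)

    -- Recursion on the membership proof avoids searching for `v` in the list; a proof that the tour
    -- is complete then turns this into a colouring.
    position-colour : ∀ {v xs} → v ∈ xs → ℕ
    position-colour (here _) = 0
    position-colour {xs = x ∷ y ∷ _} (there p) = gap x y + position-colour p

    span : List Vertex → ℕ
    span []           = 0
    span (_ ∷ [])     = 0
    span (x ∷ y ∷ ys) = gap x y + span (y ∷ ys)

    position-colour≤span : ∀ {v xs} (p : v ∈ xs) → position-colour p ≤ span xs
    position-colour≤span (here _) = z≤n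
    position-colour≤span {xs = x ∷ y ∷ _} (there p) = +-monoʳ-≤ (gap x y) (position-colour≤span p)

    Extremal : Vertex → Vertex → Set
    Extremal u v = δ u v ≡ L u + L v + ε

    L+L≤ : ∀ u v → L u + L v ≤ ℓ + ℓ
    L+L≤ u v = +-mono-≤ (L≤ℓ u) (L≤ℓ v)

    gap-defect : ∀ u v → gap u v + (L u + L v) ≡ B
    gap-defect u v = m∸n+n≡m (≤-trans (L+L≤ u v) ℓ+ℓ≤B)

    -- The equality case of the telescoping in `sorted-bound`, with gaps in place of colour
    -- differences.
    span-levels : ∀ {x y xs} → Chain Extremal x y xs →
      span xs + (levels xs + levels xs) ≡ (List.length xs ∸ 1) * B + (L x + L y)
    span-levels [ x ] = cong₂ _+_ (+-identityʳ (L x)) (+-identityʳ (L x))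
    span-levels {x} {z} (_∷_ {y = y} {xs = ys} _ ch) = begin
      gap x y + T + ((L x + S) + (L x + S))               ≡⟨ regroup (gap x y) T (L x) S ⟩
      gap x y + (L x + L x) + (T + (S + S))               ≡⟨ cong (gap x y + (L x + L x) +_) (span-levels ch) ⟩
      gap x y + (L x + L x) + (K + (L y + L z))           ≡⟨ regroup′ (gap x y) (L x) (L y) (L z) K ⟩
      gap x y + (L x + L y) + K + (L x + L z)             ≡⟨ cong (λ b → b + K + (L x + L z)) (gap-defect x y) ⟩
      B + K + (L x + L z)                                 ∎
      where
      open ≡-Reasoning
      T = span (y ∷ ys)
      S = levels (y ∷ ys)
      K = List.length ys * B
      regroup : ∀ g t x s → g + t + ((x + s) + (x + s)) ≡ g + (x + x) + (t + (s + s))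
      regroup = solve-∀
      regroup′ : ∀ g x y z k → g + (x + x) + (k + (y + z)) ≡ g + (x + y) + k + (x + z)
      regroup′ = solve-∀

    two-gaps : ∀ {u v} → u ≢ v → ∀ x y z {d} → N ≤ δ u v + (gap x y + (gap y z + d))
    two-gaps {u} {v} u≢v x y z {d} = begin
      N                                          ≤⟨ N≤ ⟩
      -- The unit that two gaps may lack is supplied by the distance of two distinct vertices.
      1 + ((B ∸ (ℓ + ℓ)) + (B ∸ (ℓ + ℓ)))        ≤⟨ +-mono-≤ (n≢0⇒n>0 (λ eq → u≢v (δ≡0⇒≡ u v eq)))
                                                      (+-mono-≤ (∸-monoʳ-≤ B (L+L≤ x y)) (∸-monoʳ-≤ B (L+L≤ y z))) ⟩
      δ u v + (gap x y + gap y z)                ≤⟨ +-monoʳ-≤ (δ u v) (+-monoʳ-≤ (gap x y) (m≤m+n _ d)) ⟩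
      δ u v + (gap x y + (gap y z + d))          ∎
      where open ≤-Reasoning

    separated-head : ∀ {x y v xs} → Chain Extremal x y (x ∷ xs) → x ≢ v → (p : v ∈ x ∷ xs) →
                     N ≤ δ x v + position-colour p
    separated-head _ x≢v (here eq) = ⊥-elim (x≢v (sym eq))
    separated-head {x} {xs = y ∷ _} (ext ∷ _) x≢v (there (here refl)) = ≤-reflexive (begin
      N                                 ≡⟨ sym B+ε≡N ⟩
      B + ε                             ≡⟨ cong (_+ ε) (sym (gap-defect x y)) ⟩
      gap x y + (L x + L y) + ε         ≡⟨ regroup (gap x y) (L x) (L y) ε ⟩
      (L x + L y + ε) + (gap x y + 0)   ≡⟨ cong (_+ (gap x y + 0)) (sym ext) ⟩
      δ x y + (gap x y + 0)             ∎)
      where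
      open ≡-Reasoning
      regroup : ∀ g x y e → g + (x + y) + e ≡ (x + y + e) + (g + 0)
      regroup = solve-∀
    separated-head {x} {xs = y ∷ z ∷ _} _ x≢v (there (there p)) = two-gaps x≢v x y z

    -- A first gap common to both positions cancels in the difference, so heads can be removed until
    -- one of the two vertices is the head.
    separated : ∀ {x y u v xs} → Chain Extremal x y xs → u ≢ v → (p : u ∈ xs) (q : v ∈ xs) →
                N ≤ δ u v + ∣ position-colour p - position-colour q ∣
    -- Splitting the chain only reveals that its first index is the head of the list.
    separated {xs = x ∷ _} ch@([ _ ]) u≢v (here refl) q = separated-head ch u≢v q
    separated {xs = x ∷ _} ch@(_ ∷ _) u≢v (here refl) q = separated-head ch u≢v q
    separated {u = u} {v} {x ∷ _} ch@(_ ∷ _) u≢v p@(there _) (here refl) =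
      ≤-trans (separated-head ch (≢-sym u≢v) p)
        (≤-reflexive (cong₂ _+_ (δ-sym v u) (sym (∣-∣-identityʳ (position-colour p)))))
    separated {u = u} {v} {x ∷ y ∷ _} (_ ∷ ch) u≢v (there p) (there q) =
      ≤-trans (separated ch u≢v p q)
        (≤-reflexive (cong (δ u v +_) (sym (∣m+n-m+o∣≡∣n-o∣ (gap x y) _ _))))

    chromatic-number : ∀ {x y xs} → Chain Extremal x y xs → Unique xs →
      (∀ v → v ∈ xs) → List.length xs ≡ suc N → L x + L y ≡ κ →
      ∃[ h ] IsHamiltonianChromaticNumber G h ×
        h + (levels xs + levels xs) ≡ N * B + κ
    chromatic-number {x} {y} {xs} ch uq complete len L+L≡κ =
      span xs , ((c , ham , attained , c≤span) , optimal) , span-eq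
      where
      c : Coloring G
      c v = position-colour (complete v)

      c≤span : ∀ v → c v ≤ span xs
      c≤span v = position-colour≤span (complete v)

      ham : IsHamiltonian G c
      ham u v u≢v = δ u v , isDetourDistance u v ,
        ≤-trans (≤-reflexive order≡) (separated ch u≢v (complete u) (complete v))

      span-eq : span xs + (levels xs + levels xs) ≡ N * B + κ
      span-eq = trans (span-levels ch) (cong₂ (λ n k → (n ∸ 1) * B + k) len L+L≡κ)

      large : ∀ c′ → IsHamiltonian G c′ → ∃[ z ] span xs ≤ c′ z
      large c′ ham′ with lower-bound c′ ham′ xs uq len
      ... | z , q = z , +-cancelʳ-≤ _ _ (c′ z) (≤-trans (≤-reflexive span-eq) q)

      attained : ∃[ v ] c v ≡ span xs
      -- The lower bound, applied to the constructed colouring itself, produces a vertex whose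
      -- colour reaches the span.
      attained with large c ham
      ... | z , q = z , ≤-antisym (c≤span z) q

      optimal : ∀ c′ h′ → IsHamiltonian G c′ → IsMaxColor G c′ h′ → span xs ≤ h′
      optimal c′ h′ ham′ (_ , c′≤h′) with large c′ ham′
      ... | z , q = ≤-trans q (c′≤h′ z)

open Optimality

-- Levels on the path and the zigzag order of the copies

module Zigzag where
  open import Data.Nat using (_+_; _*_)
  open import Data.Nat.Tactic.RingSolver using (solve-∀)


  chain-map : ∀ {A B : Set} {R : A → A → Set} {S : B → B → Set} (f : A → B) →
    (∀ {x y} → R x y → S (f x) (f y)) →
    ∀ {x y xs} → Chain R x y xs → Chain S (f x) (f y) (map f xs)
  chain-map f g [ x ]   = [ f x ]
  chain-map f g (r ∷ c) = g r ∷ chain-map f g c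

  chain-++ : ∀ {A : Set} {R : A → A → Set} {w x y z xs ys} →
    Chain R w x xs → R x y → Chain R y z ys → Chain R w z (xs ++ ys)
  chain-++ [ _ ]   r [ _ ]         = r ∷ [ _ ]
  chain-++ [ _ ]   r d@(_ ∷ _)     = r ∷ d
  chain-++ (q ∷ c) r d             = q ∷ chain-++ c r d

  length-cartesianProductWith : ∀ {A B C : Set} (f : A → B → C) xs ys →
    List.length (cartesianProductWith f xs ys) ≡ List.length xs * List.length ys
  length-cartesianProductWith f []       ys = refl
  length-cartesianProductWith f (x ∷ xs) ys =
    trans (length-++ (map (f x) ys))
          (cong₂ _+_ (length-map (f x) ys) (length-cartesianProductWith f xs ys))

  sum-map-+ : ∀ {A : Set} c (g : A → ℕ) xs →
    sum (map (λ a → c + g a) xs) ≡ List.length xs * c + sum (map g xs)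
  sum-map-+ c g []       = refl
  sum-map-+ c g (x ∷ xs) = trans (cong (c + g x +_) (sum-map-+ c g xs))
                                 (regroup c (g x) (List.length xs * c) _)
    where
    regroup : ∀ c g l s → c + g + (l + s) ≡ c + l + (g + s)
    regroup = solve-∀

  ∣-∣-bound : ∀ {m n o} → m ≤ n + o → n ≤ m + o → ∣ m - n ∣ ≤ o
  ∣-∣-bound {m} {n} m≤ n≤ with ∣m-n∣≡[m∸n]∨[n∸m] m n
  ... | inj₁ eq = ≤-trans (≤-reflexive eq) (m≤n+o⇒m∸n≤o m n m≤)
  ... | inj₂ eq = ≤-trans (≤-reflexive eq) (m≤n+o⇒m∸n≤o n m n≤)

  -- The path has m = 3 + e + 2q vertices, with e = 0 for odd m and e = 1 for even
  -- m; its weight centres are q + 1 and q + 1 + e.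
  width : Fin 2 → ℕ → ℕ
  width e zero    = 3 + toℕ e
  width e (suc q) = 2 + width e q

  width≡ : ∀ e q → width e q ≡ suc (suc q + (suc q + toℕ e))
  width≡ e zero    = refl
  width≡ e (suc q) = trans (cong (2 +_) (width≡ e q)) (regroup q (toℕ e))
    where
    regroup : ∀ q ε → 2 + suc (suc q + (suc q + ε)) ≡ suc (suc (suc q) + (suc (suc q) + ε))
    regroup = solve-∀

  -- The distance to the interval from `suc q` to `suc q + toℕ e`; at most one of the two truncated
  -- differences is positive.
  pathLevel : Fin 2 → ℕ → ℕ → ℕ
  pathLevel e q a = (suc q ∸ a) + (a ∸ (suc q + toℕ e))

  -- For each direction, climbing from `a` to the left centre, across `toℕ e`, and on from the right
  -- centre reaches at least `b`. This uses one summand of each level; the other two are slack.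
  pathLevel-upper : ∀ e q a b → ∣ a - b ∣ ≤ pathLevel e q a + pathLevel e q b + toℕ e
  pathLevel-upper e q a b = ∣-∣-bound
    (subst (λ l → a ≤ b + (l + ε)) (+-comm (pathLevel e q b) _) (half b a)) (half a b)
    where
    ε = toℕ e
    half : ∀ a b → b ≤ a + (pathLevel e q a + pathLevel e q b + ε)
    half a b = begin
      b                                              ≤⟨ m≤n+m∸n b (suc q + ε) ⟩
      suc q + ε + (b ∸ (suc q + ε))                  ≤⟨ +-monoˡ-≤ _ (+-monoˡ-≤ ε (m≤n+m∸n (suc q) a)) ⟩
      a + (suc q ∸ a) + ε + (b ∸ (suc q + ε))        ≤⟨ m≤m+n _ ((a ∸ (suc q + ε)) + (suc q ∸ b)) ⟩
      a + (suc q ∸ a) + ε + (b ∸ (suc q + ε)) + ((a ∸ (suc q + ε)) + (suc q ∸ b))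
        ≡⟨ regroup a (suc q ∸ a) ε (b ∸ (suc q + ε)) (a ∸ (suc q + ε)) (suc q ∸ b) ⟩
      a + (pathLevel e q a + pathLevel e q b + ε)    ∎
      where
      open ≤-Reasoning
      regroup : ∀ a u ε v w x → a + u + ε + v + (w + x) ≡ a + ((u + w) + (x + v) + ε)
      regroup = solve-∀

  pathLevel-max : ∀ e q {a} → a < width e q → pathLevel e q a ≤ suc q
  pathLevel-max e q {a} a<m with ≤-total a (suc q + toℕ e)
  ... | inj₁ a≤t rewrite m≤n⇒m∸n≡0 a≤t = ≤-trans (≤-reflexive (+-identityʳ _)) (m∸n≤m (suc q) a)
  ... | inj₂ t≤a rewrite m≤n⇒m∸n≡0 (≤-trans (m≤m+n (suc q) (toℕ e)) t≤a) =
    m≤n+o⇒m∸n≤o a (suc q + toℕ e) (≤-trans (≤-pred (subst (a <_) (width≡ e q) a<m))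
                                            (≤-reflexive (+-comm (suc q) _)))

  pathLevel≡0 : ∀ q a → pathLevel zero q a ≡ 0 → a ≡ suc q
  pathLevel≡0 q a eq = ≤-antisym
    (≤-trans (m∸n≡0⇒m≤n (m+n≡0⇒n≡0 (suc q ∸ a) eq)) (≤-reflexive (+-identityʳ (suc q))))
    (m∸n≡0⇒m≤n (m+n≡0⇒m≡0 (suc q ∸ a) eq))

  -- For odd m the single centre satisfies the equation with itself, but two vertices of one copy
  -- need not be joined through its root; hence the demand that the copies differ.
  Opposite : Fin 2 → ℕ → ℕ → ℕ → Set
  Opposite e q a b = ∣ a - b ∣ ≡ pathLevel e q a + pathLevel e q b + toℕ e × a ≢ b

  -- The zigzag runs through the copies from the centre outwards, alternating
  -- between the two halves of the path.
  extend : ∀ {n} → List (Fin n) → List (Fin (2 + n))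
  extend xs = map (suc ∘ inject₁) xs ++ fromℕ _ ∷ zero ∷ []

  -- For odd m these are the weight centre and its right neighbour, for even m the right and the
  -- left weight centre. Their levels sum to 1 or 0 respectively, as the ends of the tour require.
  centre₀ second₀ : ∀ e → Fin (width e 0)
  centre₀ zero       = suc zero
  centre₀ (suc zero) = suc (suc zero)
  second₀ zero       = suc (suc zero)
  second₀ (suc zero) = suc zero

  zigzag-tail₀ : ∀ e → List (Fin (width e 0))
  zigzag-tail₀ zero       = suc (suc zero) ∷ zero ∷ []
  zigzag-tail₀ (suc zero) = suc zero ∷ suc (suc (suc zero)) ∷ zero ∷ []

  centre second outer : ∀ e q → Fin (width e q)
  centre e zero    = centre₀ e
  centre e (suc q) = suc (inject₁ (centre e q))
  second e zero    = second₀ e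
  second e (suc q) = suc (inject₁ (second e q))
  outer e zero     = zero
  outer e (suc q)  = zero

  -- The tail is named separately because the tour begins with it. Extending the tail and shifting
  -- the centre is, by computation, extending the whole zigzag.
  zigzag-tail zigzag : ∀ e q → List (Fin (width e q))
  zigzag-tail e zero    = zigzag-tail₀ e
  zigzag-tail e (suc q) = extend (zigzag-tail e q)
  zigzag e q = centre e q ∷ zigzag-tail e q

  toℕ-outer : ∀ e q → toℕ (outer e q) ≡ 0
  toℕ-outer e zero    = refl
  toℕ-outer e (suc q) = refl

  toℕ-centre : ∀ e q → toℕ (centre e q) ≡ suc q + toℕ e
  toℕ-centre zero       zero    = refl
  toℕ-centre (suc zero) zero    = refl
  toℕ-centre e          (suc q) = cong suc (trans (Fin.toℕ-inject₁ _) (toℕ-centre e q))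

  toℕ-second : ∀ e q → toℕ (second e q) ≡ suc q + (1 ∸ toℕ e)
  toℕ-second zero       zero    = refl
  toℕ-second (suc zero) zero    = refl
  toℕ-second e          (suc q) = cong suc (trans (Fin.toℕ-inject₁ _) (toℕ-second e q))

  pathLevel-centre : ∀ e q → pathLevel e q (suc q + toℕ e) ≡ 0
  pathLevel-centre e q = cong₂ _+_ (m≤n⇒m∸n≡0 (m≤m+n (suc q) (toℕ e))) (n∸n≡0 (suc q + toℕ e))

  pathLevel-second : ∀ e q → pathLevel e q (suc q + (1 ∸ toℕ e)) ≡ 1 ∸ toℕ e
  pathLevel-second zero       q = cong₂ _+_ (m≤n⇒m∸n≡0 (m≤m+n (suc q) 1)) ([m+n]∸[m+o]≡n∸o (suc q) 1 0)
  pathLevel-second (suc zero) q = cong₂ _+_ (trans (cong (suc q ∸_) (+-identityʳ (suc q))) (n∸n≡0 (suc q)))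
                                            ([m+n]∸[m+o]≡n∸o (suc q) 0 1)

  pathLevel-last : ∀ e q → pathLevel e (suc q) (suc (width e q)) ≡ suc (suc q)
  pathLevel-last e q rewrite width≡ e q =
    cong₂ _+_ (m≤n⇒m∸n≡0 (≤-trans (m≤m+n (suc q) _) (n≤1+n _))) (m+n∸n≡m (suc (suc q)) (suc q + toℕ e))

  opposite-second : ∀ e q → Opposite e q (toℕ (centre e q)) (toℕ (second e q))
  opposite-second e q rewrite toℕ-centre e q | toℕ-second e q | pathLevel-centre e q | pathLevel-second e q
    = trans (∣m+n-m+o∣≡∣n-o∣ (suc q) (toℕ e) (1 ∸ toℕ e)) (distance e) , λ eq → differ e (+-cancelˡ-≡ (suc q) _ _ eq)
    where
    distance : (e : Fin 2) → ∣ toℕ e - (1 ∸ toℕ e) ∣ ≡ 1 ∸ toℕ e + toℕ e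
    distance zero       = refl
    distance (suc zero) = refl
    differ : (e : Fin 2) → toℕ e ≢ 1 ∸ toℕ e
    differ zero       ()
    differ (suc zero) ()

  -- This closes the zigzag to a cycle, so that one round can follow another and the tour can end at
  -- the centre.
  opposite-centre : ∀ e q → Opposite e q (toℕ (outer e q)) (toℕ (centre e q))
  opposite-centre e q rewrite toℕ-centre e q | toℕ-outer e q | pathLevel-centre e q
    = cong (_+ toℕ e) (sym (trans (+-identityʳ _) (+-identityʳ (suc q)))) , λ ()

  -- A new copy at the left end moves the old copies and the centres by one alike, so
  -- `pathLevel e (suc q) (suc a)` computes to `pathLevel e q a`.
  opposite-extend : ∀ e q {a b : Fin (width e q)} → Opposite e q (toℕ a) (toℕ b) →
    Opposite e (suc q) (toℕ (suc (inject₁ a))) (toℕ (suc (inject₁ b)))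
  opposite-extend e q {a} {b} (eq , a≢b) rewrite Fin.toℕ-inject₁ a | Fin.toℕ-inject₁ b =
    eq , a≢b ∘ suc-injective

  opposite-last : ∀ e q → Opposite e (suc q) (toℕ (suc (inject₁ (outer e q)))) (toℕ (fromℕ (suc (width e q))))
  opposite-last e q rewrite Fin.toℕ-inject₁ (outer e q) | toℕ-outer e q | Fin.toℕ-fromℕ (width e q)
    | pathLevel-last e q =
    trans (width≡ e q) (regroup q (toℕ e)) , λ eq → 0≢1+n (trans (suc-injective eq) (width≡ e q))
    where
    regroup : ∀ q ε → suc (suc q + (suc q + ε)) ≡ suc q + 0 + suc (suc q) + ε
    regroup = solve-∀

  opposite-ends : ∀ e q → Opposite e (suc q) (toℕ (fromℕ (suc (width e q)))) 0
  opposite-ends e q rewrite Fin.toℕ-fromℕ (width e q) | pathLevel-last e q =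
    trans (cong suc (width≡ e q)) (regroup q (toℕ e)) , λ ()
    where
    regroup : ∀ q ε → suc (suc (suc q + (suc q + ε))) ≡ suc (suc q) + (suc (suc q) + 0) + ε
    regroup = solve-∀

  OppositeCopies : ∀ e q → Fin (width e q) → Fin (width e q) → Set
  OppositeCopies e q a b = Opposite e q (toℕ a) (toℕ b)

  tail-chain : ∀ e q → Chain (OppositeCopies e q) (second e q) (outer e q) (zigzag-tail e q)
  tail-chain zero       zero    = (refl , λ ()) ∷ [ _ ]
  tail-chain (suc zero) zero    = (refl , λ ()) ∷ (refl , λ ()) ∷ [ _ ]
  tail-chain e          (suc q) =
    chain-++ (chain-map _ (opposite-extend e q) (tail-chain e q)) (opposite-last e q) (opposite-ends e q ∷ [ _ ])

  zigzag-chain : ∀ e q → Chain (OppositeCopies e q) (centre e q) (outer e q) (zigzag e q)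
  zigzag-chain e q = chain-++ [ centre e q ] (opposite-second e q) (tail-chain e q)

  extend-complete : ∀ {n} {xs : List (Fin n)} → (∀ i → i ∈ xs) → ∀ i → i ∈ extend xs
  extend-complete {xs = xs} complete zero = ∈-++⁺ʳ (map _ xs) (there (here refl))
  extend-complete {xs = xs} complete (suc i) with view i
  ... | ‵fromℕ     = ∈-++⁺ʳ (map _ xs) (here refl)
  ... | ‵inject₁ j = ∈-++⁺ˡ (∈-map⁺ _ (complete j))

  extend-unique : ∀ {n} {xs : List (Fin n)} → Unique xs → Unique (extend xs)
  extend-unique {xs = xs} uq = Unique.++⁺
    (Unique.map⁺ (Fin.inject₁-injective ∘ Fin.suc-injective) uq)
    (((λ ()) ∷ []) ∷ [] ∷ []) disjoint
    where
    disjoint : ∀ {i} → ¬ (i ∈ map (suc ∘ inject₁) xs × i ∈ fromℕ _ ∷ zero ∷ [])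
    disjoint (i∈ , here refl) with ∈-map⁻ _ i∈
    ... | _ , _ , eq = Fin.fromℕ≢inject₁ (Fin.suc-injective eq)
    disjoint (i∈ , there (here refl)) with ∈-map⁻ _ i∈
    ... | _ , _ , ()

  zigzag-complete : ∀ e q i → i ∈ zigzag e q
  zigzag-complete zero       zero zero                   = there (there (here refl))
  zigzag-complete zero       zero (suc zero)             = here refl
  zigzag-complete zero       zero (suc (suc zero))       = there (here refl)
  zigzag-complete (suc zero) zero zero                   = there (there (there (here refl)))
  zigzag-complete (suc zero) zero (suc zero)             = there (here refl)
  zigzag-complete (suc zero) zero (suc (suc zero))       = here refl
  zigzag-complete (suc zero) zero (suc (suc (suc zero))) = there (there (here refl))
  zigzag-complete e (suc q) = extend-complete (zigzag-complete e q)

  zigzag-unique : ∀ e q → Unique (zigzag e q)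
  zigzag-unique zero       zero = ((λ ()) ∷ (λ ()) ∷ []) ∷ ((λ ()) ∷ []) ∷ [] ∷ []
  zigzag-unique (suc zero) zero =
    ((λ ()) ∷ (λ ()) ∷ (λ ()) ∷ []) ∷ ((λ ()) ∷ (λ ()) ∷ []) ∷ ((λ ()) ∷ []) ∷ [] ∷ []
  zigzag-unique e (suc q) = extend-unique (zigzag-unique e q)

  length-zigzag : ∀ e q → List.length (zigzag e q) ≡ width e q
  length-zigzag zero       zero = refl
  length-zigzag (suc zero) zero = refl
  length-zigzag e (suc q) = begin
    List.length (extend (zigzag e q))                          ≡⟨ length-++ (map (suc ∘ inject₁) (zigzag e q)) ⟩
    List.length (map (suc ∘ inject₁) (zigzag e q)) + 2         ≡⟨ cong (_+ 2) (length-map _ (zigzag e q)) ⟩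
    List.length (zigzag e q) + 2                               ≡⟨ cong (_+ 2) (length-zigzag e q) ⟩
    width e q + 2                                              ≡⟨ +-comm (width e q) 2 ⟩
    2 + width e q                                              ∎
    where open ≡-Reasoning

  -- Each side contributes the levels from 1 to q + 1 and the centres contribute zero, so both
  -- parities share one formula.
  zigzag-levels : ∀ e q → sum (map (pathLevel e q ∘ toℕ) (zigzag e q)) ≡ suc q * suc (suc q)
  zigzag-levels zero       zero = refl
  zigzag-levels (suc zero) zero = refl
  zigzag-levels e (suc q) = begin
    sum (map f (extend zs))                                         ≡⟨ cong sum (map-++ f (map (suc ∘ inject₁) zs) _) ⟩
    sum (map f (map (suc ∘ inject₁) zs) ++ ends)                    ≡⟨ sum-++ (map f (map (suc ∘ inject₁) zs)) ends ⟩
    sum (map f (map (suc ∘ inject₁) zs)) + sum ends                 ≡⟨ cong₂ (λ s t → sum s + t) shifted ends-sum ⟩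
    sum (map (pathLevel e q ∘ toℕ) zs) + (suc (suc q) + suc (suc q)) ≡⟨ cong (_+ (suc (suc q) + suc (suc q))) (zigzag-levels e q) ⟩
    suc q * suc (suc q) + (suc (suc q) + suc (suc q))               ≡⟨ regroup q ⟩
    suc (suc q) * suc (suc (suc q))                                 ∎
    where
    open ≡-Reasoning
    zs = zigzag e q
    f : Fin (width e (suc q)) → ℕ
    f = pathLevel e (suc q) ∘ toℕ
    ends = f (fromℕ _) ∷ f zero ∷ []
    shifted : map f (map (suc ∘ inject₁) zs) ≡ map (pathLevel e q ∘ toℕ) zs
    shifted = trans (sym (map-∘ zs)) (map-cong (λ i → cong (pathLevel e q) (Fin.toℕ-inject₁ i)) zs)
    ends-sum : sum ends ≡ suc (suc q) + suc (suc q)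
    ends-sum = cong₂ _+_ (trans (cong (pathLevel e (suc q) ∘ suc) (Fin.toℕ-fromℕ (width e q))) (pathLevel-last e q))
                         (trans (+-identityʳ _) (+-identityʳ (suc (suc q))))
    regroup : ∀ q → suc q * suc (suc q) + (suc (suc q) + suc (suc q)) ≡ suc (suc q) * suc (suc (suc q))
    regroup = solve-∀

  -- Levels of the firecracker and its tour

  starDistance-sym : ∀ {k} (x y : Fin (suc k)) → starDistance x y ≡ starDistance y x
  starDistance-sym zero    zero    = refl
  starDistance-sym zero    (suc _) = refl
  starDistance-sym (suc _) zero    = refl
  starDistance-sym (suc i) (suc j) with i Fin.≟ j | j Fin.≟ i
  ... | yes _    | yes _    = refl
  ... | no  _    | no  _    = refl
  ... | yes refl | no  j≢i  = ⊥-elim (j≢i refl)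
  ... | no  i≢j  | yes refl = ⊥-elim (i≢j refl)

  module Firecracker (e : Fin 2) (q j : ℕ) where

    m = width e q
    ε = toℕ e
    κ = 1 ∸ ε

    root : Fin (4 + j)
    root = suc zero

    G : ConnectedGraph
    G = attachCopies (pathGraph m) (starGraph (3 + j)) root

    Vertex : Set
    Vertex = Fin m × Fin (4 + j)

    copyDistance : ℕ → Fin (4 + j) → Fin (4 + j) → ℕ
    copyDistance = attachDistance root (path-tree m) (star-tree (3 + j))

    δ : Vertex → Vertex → ℕ
    δ u v = copyDistance ∣ toℕ (proj₁ u) - toℕ (proj₁ v) ∣ (proj₂ u) (proj₂ v)

    tree : IsTreeMetric G δ
    tree = attach-tree root (path-tree m) (star-tree (3 + j))

    starLevel : Fin (4 + j) → ℕ
    starLevel x = starDistance x root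

    L : Vertex → ℕ
    L (a , x) = starLevel x + pathLevel e q (toℕ a)

    δ-sym : ∀ u v → δ u v ≡ δ v u
    δ-sym (a , x) (b , y) = trans (cong (λ d → copyDistance d x y) (∣-∣-comm (toℕ a) (toℕ b)))
                                  (flip ∣ toℕ b - toℕ a ∣)
      where
      regroup : ∀ d x y → x + (d + y) ≡ y + (d + x)
      regroup = solve-∀
      flip : ∀ d → copyDistance d x y ≡ copyDistance d y x
      flip zero    = starDistance-sym x y
      flip (suc d) = trans (cong (λ s → starLevel x + (suc d + s)) (starDistance-sym root y))
        (trans (regroup (suc d) (starLevel x) (starLevel y))
               (cong (λ s → starLevel y + (suc d + s)) (starDistance-sym x root)))

    starDistance-triangle : ∀ x y → starDistance x y ≤ starLevel x + starLevel y
    starDistance-triangle zero    zero    = z≤n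
    starDistance-triangle zero    (suc _) = s≤s z≤n
    starDistance-triangle (suc i) zero    = m≤n+m 1 (starLevel (suc i))
    starDistance-triangle (suc i) (suc l) with i Fin.≟ l
    starDistance-triangle (suc i) (suc l)          | yes _ = z≤n
    starDistance-triangle (suc zero) (suc zero)    | no ¬p = ⊥-elim (¬p refl)
    starDistance-triangle (suc zero) (suc (suc l)) | no _  = ≤-refl
    starDistance-triangle (suc (suc i)) (suc l)    | no _  = m≤m+n 2 (starLevel (suc l))

    copyDistance-upper : ∀ d x y → copyDistance d x y ≤ starLevel x + (d + starLevel y)
    copyDistance-upper zero    x y = starDistance-triangle x y
    copyDistance-upper (suc d) x y =
      ≤-reflexive (cong (λ s → starLevel x + (suc d + s)) (starDistance-sym root y))

    private
      regroup : ∀ x y a b ε → x + (a + b + ε + y) ≡ (x + a) + (y + b) + ε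
      regroup = solve-∀

    δ≤ : ∀ u v → δ u v ≤ L u + L v + ε
    δ≤ (a , x) (b , y) = ≤-trans (copyDistance-upper _ x y)
      (≤-trans (+-monoʳ-≤ (starLevel x) (+-monoˡ-≤ (starLevel y) (pathLevel-upper e q (toℕ a) (toℕ b))))
               (≤-reflexive (regroup (starLevel x) (starLevel y) _ _ ε)))

    -- The copies differ, so the detour passes through both roots and uses the star parts of both
    -- levels in full, whatever `x` and `y` are.
    extremal : ∀ {a b} x y → OppositeCopies e q a b → δ (a , x) (b , y) ≡ L (a , x) + L (b , y) + ε
    extremal {a} {b} x y (eq , a≢b) = trans (apart ∣ toℕ a - toℕ b ∣ (a≢b ∘ ∣m-n∣≡0⇒m≡n))
      (trans (cong (λ d → starLevel x + (d + starLevel y)) eq)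
             (regroup (starLevel x) (starLevel y) _ _ ε))
      where
      apart : ∀ d → d ≢ 0 → copyDistance d x y ≡ starLevel x + (d + starLevel y)
      apart zero    d≢0 = ⊥-elim (d≢0 refl)
      apart (suc d) _   = cong (λ s → starLevel x + (suc d + s)) (starDistance-sym root y)

    starLevel≤2 : ∀ x → starLevel x ≤ 2
    starLevel≤2 zero          = s≤s z≤n
    starLevel≤2 (suc zero)    = z≤n
    starLevel≤2 (suc (suc _)) = ≤-refl

    ℓ : ℕ
    ℓ = 2 + suc q

    L≤ℓ : ∀ v → L v ≤ ℓ
    L≤ℓ (a , x) = +-mono-≤ (starLevel≤2 x) (pathLevel-max e q (Fin.toℕ<n a))

    -- Only odd m needs an argument: there the root of the central copy is the only vertex of level
    -- zero.
    κ≤ : ∀ u v → u ≢ v → κ ≤ L u + L v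
    κ≤ u v u≢v = lemma e refl
      where
      L≡0 : e ≡ zero → ∀ u → L u ≡ 0 → (toℕ (proj₁ u) , proj₂ u) ≡ (suc q , root)
      L≡0 refl (a , x) eq = cong₂ _,_ (pathLevel≡0 q (toℕ a) (m+n≡0⇒n≡0 (starLevel x) eq))
        (IsTreeMetric.δ≡0⇒≡ (star-tree (3 + j)) x root (m+n≡0⇒m≡0 (starLevel x) eq))
      lemma : ∀ e′ → e ≡ e′ → 1 ∸ toℕ e′ ≤ L u + L v
      lemma (suc zero) _ = z≤n
      lemma zero e≡0 = n≢0⇒n>0 λ eq →
        let p = trans (L≡0 e≡0 u (m+n≡0⇒m≡0 (L u) eq)) (sym (L≡0 e≡0 v (m+n≡0⇒n≡0 (L u) eq)))
        in u≢v (cong₂ _,_ (Fin.toℕ-injective (cong proj₁ p)) (cong proj₂ p))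

    module Number (B N : ℕ) (order≡ : m * (4 + j) ≡ suc N) (B+ε≡N : B + ε ≡ N)
      (ℓ+ℓ≤B : ℓ + ℓ ≤ B) (N≤ : N ≤ suc ((B ∸ (ℓ + ℓ)) + (B ∸ (ℓ + ℓ)))) (1≤N : 1 ≤ N) where

      open Optimum tree δ-sym L ε κ ℓ B N (cong (_∸ 1) order≡) B+ε≡N δ≤ κ≤ L≤ℓ ℓ+ℓ≤B N≤ 1≤N

      place : Fin (4 + j) → Fin m → Vertex
      place x a = a , x

      leaf : Fin (2 + j) → Fin (4 + j)
      leaf x = suc (suc x)

      otherStarVertices starVertices : List (Fin (4 + j))
      otherStarVertices = zero ∷ map leaf (allFin (2 + j))
      starVertices = root ∷ otherStarVertices

      starVertices-complete : ∀ x → x ∈ starVertices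
      starVertices-complete zero          = there (here refl)
      starVertices-complete (suc zero)    = here refl
      starVertices-complete (suc (suc x)) = there (there (∈-map⁺ leaf (∈-allFin x)))

      starVertices-unique : Unique starVertices
      starVertices-unique =
        ((λ ()) ∷ All.tabulate (λ { x∈ refl → lemma₁ (∈-map⁻ leaf x∈) }))
        ∷ All.tabulate (λ { x∈ refl → lemma₂ (∈-map⁻ leaf x∈) })
        ∷ Unique.map⁺ {f = leaf} (Fin.suc-injective ∘ Fin.suc-injective) (Unique.allFin⁺ (2 + j))
        where
        lemma₁ : ¬ (∃[ x ] x ∈ allFin (2 + j) × root ≡ suc (suc x))
        lemma₁ (_ , _ , ())
        lemma₂ : ¬ (∃[ x ] x ∈ allFin (2 + j) × zero ≡ suc (suc x))
        lemma₂ (_ , _ , ())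

      length-starVertices : List.length starVertices ≡ 4 + j
      length-starVertices = cong (2 +_) (trans (length-map _ (allFin (2 + j))) (length-tabulate {n = 2 + j} id))

      starVertices-levels : sum (map starLevel starVertices) ≡ 1 + (2 + j) * 2
      starVertices-levels = cong suc (trans (twos (allFin (2 + j))) (cong (_* 2) (length-tabulate {n = 2 + j} id)))
        where
        twos : ∀ xs → sum (map starLevel (map leaf xs)) ≡ List.length xs * 2
        twos []       = refl
        twos (x ∷ xs) = cong (2 +_) (twos xs)

      product : List (Fin (4 + j)) → List Vertex
      product xs = cartesianProductWith place xs (zigzag e q)

      product-levels : ∀ xs → levels (product xs) ≡
        m * sum (map starLevel xs) + List.length xs * (suc q * suc (suc q))
      product-levels [] = sym (trans (+-identityʳ _) (*-zeroʳ m))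
      product-levels (x ∷ xs) = begin
        sum (map L (map (place x) zs ++ product xs))               ≡⟨ cong sum (map-++ L (map (place x) zs) (product xs)) ⟩
        sum (map L (map (place x) zs) ++ map L (product xs))       ≡⟨ sum-++ (map L (map (place x) zs)) _ ⟩
        sum (map L (map (place x) zs)) + levels (product xs)       ≡⟨ cong₂ (λ s t → sum s + t) (sym (map-∘ zs)) (product-levels xs) ⟩
        sum (map (λ a → starLevel x + pathLevel e q (toℕ a)) zs) + (m * S + K * P)
          ≡⟨ cong (_+ (m * S + K * P)) (sum-map-+ (starLevel x) _ zs) ⟩
        List.length zs * starLevel x + sum (map (pathLevel e q ∘ toℕ) zs) + (m * S + K * P)
          ≡⟨ cong₂ (λ n p → n * starLevel x + p + (m * S + K * P)) (length-zigzag e q) (zigzag-levels e q) ⟩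
        m * starLevel x + P + (m * S + K * P)                      ≡⟨ collect m (starLevel x) P S (K * P) ⟩
        m * (starLevel x + S) + (P + K * P)                        ∎
        where
        open ≡-Reasoning
        zs = zigzag e q
        S = sum (map starLevel xs)
        K = List.length xs
        P = suc q * suc (suc q)
        collect : ∀ m x p s k → m * x + p + (m * s + k) ≡ m * (x + s) + (p + k)
        collect = solve-∀

      -- Each round ends in the outer copy, opposite the centre copy in which the next one starts,
      -- and `extremal` lets the star vertex change there.
      rounds : ∀ xs {u x us} → Chain Extremal u (outer e q , x) us →
               ∃[ y ] Chain Extremal u (outer e q , y) (us ++ product xs)
      rounds [] {us = us} ch = _ , subst (Chain Extremal _ _) (sym (++-identityʳ us)) ch
      rounds (y ∷ xs) {x = x} {us} ch
        with rounds xs (chain-++ ch (extremal x y (opposite-centre e q))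
                                 (chain-map (place y) (extremal y y) (zigzag-chain e q)))
      ... | z , ch′ = z , subst (Chain Extremal _ _) (++-assoc us _ (product xs)) ch′

      -- The first vertex, a weight centre, is moved to the end, so that the tour starts
      -- and ends at vertices of minimal total level.
      tour : List Vertex
      tour = (map (place root) (zigzag-tail e q) ++ product otherStarVertices) ++ (centre e q , root) ∷ []

      tour-chain : Chain Extremal (second e q , root) (centre e q , root) tour
      tour-chain with rounds otherStarVertices (chain-map (place root) (extremal root root) (tail-chain e q))
      ... | y , ch = chain-++ ch (extremal y root (opposite-centre e q)) [ _ ]

      -- The tour is the product list rotated by one entry. Uniqueness, completeness, length and
      -- level sum are obtained on the product and carried over.
      product↭tour : product starVertices ↭ tour
      product↭tour = Perm.∷↭∷ʳ (centre e q , root) _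

      tour-unique : Unique tour
      tour-unique = PermS.Unique-resp-↭ (setoid Vertex) (↭⇒↭ₛ product↭tour)
        (Unique.cartesianProductWith⁺ place (λ { refl → refl , refl }) starVertices-unique (zigzag-unique e q))

      tour-complete : ∀ v → v ∈ tour
      tour-complete (a , x) = Perm.∈-resp-↭ product↭tour
        (∈-cartesianProductWith⁺ place (starVertices-complete x) (zigzag-complete e q a))

      length-tour : List.length tour ≡ suc N
      length-tour = begin
        List.length tour                                     ≡⟨ Perm.↭-length product↭tour ⟨
        List.length (product starVertices)                   ≡⟨ length-cartesianProductWith place starVertices (zigzag e q) ⟩
        List.length starVertices * List.length (zigzag e q)  ≡⟨ cong₂ _*_ length-starVertices (length-zigzag e q) ⟩
        (4 + j) * m                                          ≡⟨ *-comm (4 + j) m ⟩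
        m * (4 + j)                                          ≡⟨ order≡ ⟩
        suc N                                                ∎
        where open ≡-Reasoning

      -- The level sum of the whole graph. In each copy the root, the star centre and the other k -
      -- 2 leaves have star levels 0, 1 and 2; the path levels are counted once for each of the k
      -- star vertices.
      S : ℕ
      S = m * (1 + (2 + j) * 2) + (4 + j) * (suc q * suc (suc q))

      tour-levels : levels tour ≡ S
      tour-levels = begin
        levels tour                    ≡⟨ sum-↭ (Perm.map⁺ L product↭tour) ⟨
        levels (product starVertices)  ≡⟨ product-levels starVertices ⟩
        _                              ≡⟨ cong₂ (λ s k → m * s + k * (suc q * suc (suc q)))
                                                starVertices-levels length-starVertices ⟩
        S                              ∎
        where open ≡-Reasoning

      ends-level : L (second e q , root) + L (centre e q , root) ≡ κ
      ends-level = trans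
        (cong₂ _+_ (trans (cong (pathLevel e q) (toℕ-second e q)) (pathLevel-second e q))
                   (trans (cong (pathLevel e q) (toℕ-centre e q)) (pathLevel-centre e q)))
        (+-identityʳ κ)

      number : ∃[ h ] IsHamiltonianChromaticNumber G h × h + (S + S) ≡ N * B + κ
      number =
        let h , hc , eq = chromatic-number tour-chain tour-unique tour-complete length-tour ends-level
        in h , hc , subst (λ s → h + (s + s) ≡ N * B + κ) tour-levels eq

  -- Size conditions and the closed form in natural numbers

  sizes : ∀ e q j → let ℓ = 2 + suc q in ∃₂ λ N B →
    width e q * (4 + j) ≡ suc N × B + toℕ e ≡ N × ℓ + ℓ ≤ B
      × N ≤ suc ((B ∸ (ℓ + ℓ)) + (B ∸ (ℓ + ℓ))) × 1 ≤ N
  sizes e q j = B + ε , B , order≡ , refl , m≤m+n (ℓ + ℓ) slack , two-gaps , s≤s z≤n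
    where
    ε = toℕ e

    slack ℓ B : ℕ
    -- This is `m k - 1 - ε - 2 ℓ` expanded for m = 3 + `ε` + 2q and k = 4 + j; it is also the least
    -- possible gap.
    slack = 5 + 3 * ε + 6 * q + j * (3 + ε + 2 * q)
    ℓ = 2 + suc q
    B = ℓ + ℓ + slack

    order≡ : width e q * (4 + j) ≡ suc (B + ε)
    order≡ = trans (cong (_* (4 + j)) (width≡ e q)) (expand q ε j)
      where
      expand : ∀ q ε j → suc (suc q + (suc q + ε)) * (4 + j) ≡
        suc ((2 + suc q) + (2 + suc q) + (5 + 3 * ε + 6 * q + j * (3 + ε + 2 * q)) + ε)
      expand = solve-∀

    two-gaps : B + ε ≤ suc ((B ∸ (ℓ + ℓ)) + (B ∸ (ℓ + ℓ)))
    -- The added term is the exact excess of the right side; it vanishes for m = 3 and k = 4.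
    two-gaps = ≤-trans (m≤m+n (B + ε) (2 * ε + 4 * q + j * (3 + ε + 2 * q)))
      (≤-reflexive (trans (expand q ε (j * (3 + ε + 2 * q)))
                            (cong (λ s → suc (s + s)) (sym (m+n∸m≡n (ℓ + ℓ) slack)))))
      where
      expand : ∀ q ε t → (2 + suc q) + (2 + suc q) + (5 + 3 * ε + 6 * q + t) + ε + (2 * ε + 4 * q + t) ≡
        suc ((5 + 3 * ε + 6 * q + t) + (5 + 3 * ε + 6 * q + t))
      expand = solve-∀

  Certificate : Fin 2 → ℕ → ℕ → Set
  Certificate e q j = ∃₂ λ N B → ∃[ h ]
    IsHamiltonianChromaticNumber (attachCopies (pathGraph m) (starGraph (3 + j)) (suc zero)) h
      × m * (4 + j) ≡ suc N × B + toℕ e ≡ N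
      × h + (S + S) ≡ N * B + (1 ∸ toℕ e)
    where
    m = width e q
    S = m * (1 + (2 + j) * 2) + (4 + j) * (suc q * suc (suc q))

  firecracker-number : ∀ e q j → Certificate e q j
  firecracker-number e q j with sizes e q j
  ... | N , B , order≡ , B+ε≡N , ℓ+ℓ≤B , N≤ , 1≤N =
    let h , hc , eq = Firecracker.Number.number e q j B N order≡ B+ε≡N ℓ+ℓ≤B N≤ 1≤N
    in N , B , h , hc , order≡ , B+ε≡N , eq

  -- The 2mk lost in passing from (mk)^2 to `N * N`, together with twice the star part 2m(2k - 3),
  -- makes 6m(k - 1). In the application `P` is (m^2 - 1)/4, so the last term is k(m^2 - 1)/2.
  odd-value : ∀ m j P {h N} → m * (4 + j) ≡ suc N →
    (let S = m * (1 + (2 + j) * 2) + (4 + j) * P) →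
    h + (S + S) ≡ N * N + 1 →
    h + (6 * m) * (3 + j) + (4 + j) * (2 * P) ≡ suc N * suc N + 2
  odd-value m j P {h} {N} n≡ eq = +-cancelʳ-≡ (S + S) _ _ (begin
    h + (6 * m) * (3 + j) + x + (S + S)            ≡⟨ swap h ((6 * m) * (3 + j)) x (S + S) ⟩
    h + (S + S) + ((6 * m) * (3 + j) + x)          ≡⟨ cong₂ (λ a b → a + (b + x)) eq (split m j) ⟩
    N * N + 1 + (m * (4 + j) + m * (4 + j) + T + x)
      ≡⟨ cong (λ n → N * N + 1 + (n + n + T + x)) n≡ ⟩
    N * N + 1 + (suc N + suc N + T + x)            ≡⟨ collect N m j P ⟩
    suc N * suc N + 2 + (S + S)                    ∎)
    where
    open ≡-Reasoning
    S = m * (1 + (2 + j) * 2) + (4 + j) * P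
    T = 2 * (m * (1 + (2 + j) * 2))
    x = (4 + j) * (2 * P)
    swap : ∀ h a x s → h + a + x + s ≡ h + s + (a + x)
    swap = solve-∀
    split : ∀ m j → (6 * m) * (3 + j) ≡ m * (4 + j) + m * (4 + j) + 2 * (m * (1 + (2 + j) * 2))
    split = solve-∀
    collect : ∀ N m j P →
      N * N + 1 + (suc N + suc N + 2 * (m * (1 + (2 + j) * 2)) + (4 + j) * (2 * P)) ≡
      suc N * suc N + 2 + ((m * (1 + (2 + j) * 2) + (4 + j) * P) + (m * (1 + (2 + j) * 2) + (4 + j) * P))
    collect = solve-∀

  -- The product (n - 1)(n - 2) loses 3mk against n^2. Two of these enter 6m(k - 1) as in the odd
  -- case; the third completes 2kp(p + 1) to 2k(p + 1)^2, which is km^2/2.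
  even-value : ∀ m j p {h B} → m ≡ 2 * suc p → m * (4 + j) ≡ 2 + B →
    (let S = m * (1 + (2 + j) * 2) + (4 + j) * (p * suc p)) →
    h + (S + S) ≡ suc B * B →
    h + (6 * m) * (3 + j) + (4 + j) * (2 * (suc p * suc p)) ≡ (2 + B) * (2 + B) + 2
  even-value m j p {h} {B} m≡ n≡ eq = +-cancelʳ-≡ (S + S) _ _ (begin
    h + (6 * m) * (3 + j) + x + (S + S)            ≡⟨ swap h ((6 * m) * (3 + j)) x (S + S) ⟩
    h + (S + S) + ((6 * m) * (3 + j) + x)          ≡⟨ cong₂ (λ a b → a + (b + x)) eq (split m j) ⟩
    suc B * B + (m * (4 + j) + m * (4 + j) + T + x)
      ≡⟨ cong (λ y → suc B * B + (m * (4 + j) + m * (4 + j) + T + y)) x≡ ⟩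
    suc B * B + (m * (4 + j) + m * (4 + j) + T + (m * (4 + j) + (4 + j) * (2 * (p * suc p))))
      ≡⟨ cong (λ n → suc B * B + (n + n + T + (n + (4 + j) * (2 * (p * suc p))))) n≡ ⟩
    suc B * B + (2 + B + (2 + B) + T + (2 + B + (4 + j) * (2 * (p * suc p))))
      ≡⟨ collect B m j (p * suc p) ⟩
    (2 + B) * (2 + B) + 2 + (S + S)                ∎)
    where
    open ≡-Reasoning
    S = m * (1 + (2 + j) * 2) + (4 + j) * (p * suc p)
    T = 2 * (m * (1 + (2 + j) * 2))
    x = (4 + j) * (2 * (suc p * suc p))
    swap : ∀ h a x s → h + a + x + s ≡ h + s + (a + x)
    swap = solve-∀
    split : ∀ m j → (6 * m) * (3 + j) ≡ m * (4 + j) + m * (4 + j) + 2 * (m * (1 + (2 + j) * 2))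
    split = solve-∀
    expand : ∀ p j → (4 + j) * (2 * (suc p * suc p)) ≡ 2 * suc p * (4 + j) + (4 + j) * (2 * (p * suc p))
    expand = solve-∀
    x≡ : x ≡ m * (4 + j) + (4 + j) * (2 * (p * suc p))
    x≡ = trans (expand p j) (cong (λ m → m * (4 + j) + (4 + j) * (2 * (p * suc p))) (sym m≡))
    collect : ∀ B m j P →
      suc B * B + (2 + B + (2 + B) + 2 * (m * (1 + (2 + j) * 2)) + (2 + B + (4 + j) * (2 * P))) ≡
      (2 + B) * (2 + B) + 2 + ((m * (1 + (2 + j) * 2) + (4 + j) * P) + (m * (1 + (2 + j) * 2) + (4 + j) * P))
    collect = solve-∀

open Zigzag

-- The formula over the integers

open import Data.Integer using (+_; _+_; _-_; _*_; _^_)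
open import Data.Integer.DivMod using (_/_; div-pos-is-/ℕ)

+-square : ∀ m → (+ m) ^ 2 ≡ + (m ℕ.* m)
+-square m = trans (cong (+ m *_) (ℤ.*-identityʳ (+ m))) (sym (ℤ.pos-* m m))

half : ∀ {i} x → i ≡ + (x ℕ.* 2) → i / + 2 ≡ + x
half x refl = trans (div-pos-is-/ℕ (+ (x ℕ.* 2)) 2) (cong +_ (m*n/n≡m x 2))

isolate : ∀ h s a x → h + a + x ≡ s + + 2 → h ≡ s - a - x + + 2
isolate h s a x eq = begin
  h                      ≡⟨ cancel h a x ⟩
  h + a + x - a - x      ≡⟨ cong (λ t → t - a - x) eq ⟩
  s + + 2 - a - x        ≡⟨ reorder s a x ⟩
  s - a - x + + 2        ∎
  where
  open ≡-Reasoning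
  cancel : ∀ h a x → h ≡ h + a + x - a - x
  cancel = ℤSolver.solve-∀
  reorder : ∀ s a x → s + + 2 - a - x ≡ s - a - x + + 2
  reorder = ℤSolver.solve-∀

pred-order : ∀ j → + (3 ℕ.+ j) ≡ + (4 ℕ.+ j) - + 1
pred-order j = refl

product-square : ∀ m k → + (m ℕ.* k ℕ.* (m ℕ.* k)) ≡ (+ m) ^ 2 * (+ k) ^ 2
product-square m k = begin
  + (m ℕ.* k ℕ.* (m ℕ.* k))    ≡⟨ cong +_ (rearrange m k) ⟩
  + (m ℕ.* m ℕ.* (k ℕ.* k))    ≡⟨ ℤ.pos-* (m ℕ.* m) (k ℕ.* k) ⟩
  + (m ℕ.* m) * + (k ℕ.* k)    ≡⟨ cong₂ _*_ (+-square m) (+-square k) ⟨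
  (+ m) ^ 2 * (+ k) ^ 2        ∎
  where
  open ≡-Reasoning
  rearrange : ∀ m k → m ℕ.* k ℕ.* (m ℕ.* k) ≡ m ℕ.* m ℕ.* (k ℕ.* k)
  rearrange = ℕSolver.solve-∀

linear-term : ∀ m j → + ((6 ℕ.* m) ℕ.* (3 ℕ.+ j)) ≡ + 6 * + m * (+ (4 ℕ.+ j) - + 1)
linear-term m j = trans (ℤ.pos-* (6 ℕ.* m) (3 ℕ.+ j)) (cong₂ _*_ (ℤ.pos-* 6 m) (pred-order j))

module _ m j {h n x} i (n≡ : m ℕ.* (4 ℕ.+ j) ≡ n) (i≡ : i ≡ + (x ℕ.* 2))
         (eq : h ℕ.+ (6 ℕ.* m) ℕ.* (3 ℕ.+ j) ℕ.+ x ≡ n ℕ.* n ℕ.+ 2) where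

  -- It serves both parities: `i` is the numerator of the halved term, and `i≡` makes the integer
  -- division exact.
  integer-value : + h ≡ (+ m) ^ 2 * (+ (4 ℕ.+ j)) ^ 2 - + 6 * + m * (+ (4 ℕ.+ j) - + 1) - i / + 2 + + 2
  integer-value = trans (isolate (+ h) (+ (n ℕ.* n)) (+ a) (+ x) total)
    (trans (cong (λ s → s - + a - + x + + 2) square)
    (trans (cong (λ t → (+ m) ^ 2 * (+ (4 ℕ.+ j)) ^ 2 - t - + x + + 2) (linear-term m j))
           (cong (λ t → (+ m) ^ 2 * (+ (4 ℕ.+ j)) ^ 2 - + 6 * + m * (+ (4 ℕ.+ j) - + 1) - t + + 2)
                 (sym (half x i≡)))))
    where
    a = (6 ℕ.* m) ℕ.* (3 ℕ.+ j)
    square : + (n ℕ.* n) ≡ (+ m) ^ 2 * (+ (4 ℕ.+ j)) ^ 2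
    square = trans (cong (λ n → + (n ℕ.* n)) (sym n≡)) (product-square m (4 ℕ.+ j))
    total : + h + + a + + x ≡ + (n ℕ.* n) + + 2
    total = cong +_ eq

width-odd : ∀ q → width zero q ≡ 2 ℕ.* suc q ℕ.+ 1
width-odd q = trans (width≡ zero q) (+-comm 1 (2 ℕ.* suc q))

width-even : ∀ q → width (suc zero) q ≡ 2 ℕ.* suc (suc q)
width-even q = trans (width≡ (suc zero) q) (expand q)
  where
  expand : ∀ q → suc (suc q ℕ.+ (suc q ℕ.+ 1)) ≡ 2 ℕ.* suc (suc q)
  expand = ℕSolver.solve-∀

odd-product : ∀ q k → let M = + width zero q in
  + k * (M ^ 2 - + 1) ≡ + (k ℕ.* (2 ℕ.* (suc q ℕ.* suc (suc q))) ℕ.* 2)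
odd-product q k = begin
  + k * (M ^ 2 - + 1)      ≡⟨ cong (λ s → + k * (s - + 1)) (trans (+-square (width zero q)) (cong +_ square)) ⟩
  + k * + y                ≡⟨ ℤ.pos-* k y ⟨
  + (k ℕ.* y)              ≡⟨ cong +_ (regroup k (suc q ℕ.* suc (suc q))) ⟩
  + (k ℕ.* (2 ℕ.* (suc q ℕ.* suc (suc q))) ℕ.* 2) ∎
  where
  open ≡-Reasoning
  M = + width zero q
  y = 4 ℕ.* (suc q ℕ.* suc (suc q))
  expand : ∀ q → (2 ℕ.* suc q ℕ.+ 1) ℕ.* (2 ℕ.* suc q ℕ.+ 1) ≡ suc (4 ℕ.* (suc q ℕ.* suc (suc q)))
  expand = ℕSolver.solve-∀
  square : width zero q ℕ.* width zero q ≡ suc y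
  square = trans (cong₂ ℕ._*_ (width-odd q) (width-odd q)) (expand q)
  regroup : ∀ k p → k ℕ.* (4 ℕ.* p) ≡ k ℕ.* (2 ℕ.* p) ℕ.* 2
  regroup = ℕSolver.solve-∀

even-product : ∀ q k → let M = + width (suc zero) q in
  + k * M ^ 2 ≡ + (k ℕ.* (2 ℕ.* (suc (suc q) ℕ.* suc (suc q))) ℕ.* 2)
even-product q k = begin
  + k * (+ m) ^ 2        ≡⟨ cong (+ k *_) (+-square m) ⟩
  + k * + (m ℕ.* m)    ≡⟨ ℤ.pos-* k (m ℕ.* m) ⟨
  + (k ℕ.* (m ℕ.* m))  ≡⟨ cong (λ m → + (k ℕ.* (m ℕ.* m))) (width-even q) ⟩
  _                    ≡⟨ cong +_ (regroup k (suc (suc q))) ⟩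
  + (k ℕ.* (2 ℕ.* (suc (suc q) ℕ.* suc (suc q))) ℕ.* 2) ∎
  where
  open ≡-Reasoning
  m = width (suc zero) q
  regroup : ∀ k p → k ℕ.* (2 ℕ.* p ℕ.* (2 ℕ.* p)) ≡ k ℕ.* (2 ℕ.* (p ℕ.* p)) ℕ.* 2
  regroup = ℕSolver.solve-∀

-- Parity of m and the final statement

2∤width-odd : ∀ q → ¬ (2 ∣ width zero q)
2∤width-odd q d
  with ∣1⇒≡1 (∣m+n∣m⇒∣n (subst (2 ∣_) (width-odd q) d) (divides (suc q) (*-comm 2 (suc q))))
... | ()

2∣width-even : ∀ q → 2 ∣ width (suc zero) q
2∣width-even q = divides (suc (suc q)) (trans (width-even q) (*-comm 2 (suc (suc q))))

-- Matching on this view replaces m by `width e q` everywhere in the claim, including the graph, so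
-- no transport along an equation for m is needed.
data Width : ℕ → Set where
  width-of : ∀ e q → Width (width e q)

toWidth : ∀ n → Width (3 ℕ.+ n)
toWidth 0 = width-of zero 0
toWidth 1 = width-of (suc zero) 0
toWidth (suc (suc n)) with toWidth n
... | w = lift w
  where
  lift : ∀ {m} → Width m → Width (2 ℕ.+ m)
  lift (width-of e q) = width-of e (suc q)

Claim : (m k : ℕ) → 4 ≤ k → Set
Claim m k 4≤k =
  let M = + m
      K = + k
  in ∃[ h ] IsHamiltonianChromaticNumber (firecracker m k (≤-trans (s≤s (s≤s z≤n)) 4≤k)) h
       × (¬ (2 ∣ m) → + h ≡ M ^ 2 * K ^ 2 - + 6 * M * (K - + 1) - (K * (M ^ 2 - + 1)) / + 2 + + 2)
       × (2 ∣ m → + h ≡ M ^ 2 * K ^ 2 - + 6 * M * (K - + 1) - (K * M ^ 2) / + 2 + + 2)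

-- The root of the copies is suc (fromℕ< _), which reduces to suc zero.
firecracker≡ : ∀ m j (2≤k : 2 ≤ 4 ℕ.+ j) →
  attachCopies (pathGraph m) (starGraph (3 ℕ.+ j)) (suc zero) ≡ firecracker m (4 ℕ.+ j) 2≤k
firecracker≡ m j (s≤s (s≤s _)) = refl

odd-claim : ∀ q j (4≤k : 4 ≤ 4 ℕ.+ j) → Certificate zero q j → Claim (width zero q) (4 ℕ.+ j) 4≤k
odd-claim q j 4≤k (N , B , h , hc , n≡ , B≡N , eq) = h ,
  subst (λ G → IsHamiltonianChromaticNumber G h) (firecracker≡ m j (≤-trans (s≤s (s≤s z≤n)) 4≤k)) hc ,
  (λ _ → integer-value m j (+ (4 ℕ.+ j) * ((+ m) ^ 2 - + 1)) n≡ (odd-product q (4 ℕ.+ j))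
           (odd-value m j (suc q ℕ.* suc (suc q)) n≡
             (trans eq (cong (λ B → N ℕ.* B ℕ.+ 1) (trans (sym (+-identityʳ B)) B≡N))))) ,
  λ 2∣m → ⊥-elim (2∤width-odd q 2∣m)
  where
  m = width zero q

even-claim : ∀ q j (4≤k : 4 ≤ 4 ℕ.+ j) → Certificate (suc zero) q j → Claim (width (suc zero) q) (4 ℕ.+ j) 4≤k
even-claim q j 4≤k (N , B , h , hc , n≡ , B≡N , eq) = h ,
  subst (λ G → IsHamiltonianChromaticNumber G h) (firecracker≡ m j (≤-trans (s≤s (s≤s z≤n)) 4≤k)) hc ,
  (λ 2∤m → ⊥-elim (2∤m (2∣width-even q))) ,
  λ _ → integer-value m j (+ (4 ℕ.+ j) * (+ m) ^ 2) n≡′ (even-product q (4 ℕ.+ j))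
          (even-value m j (suc q) (width-even q) n≡′
            (trans eq (trans (+-identityʳ (N ℕ.* B)) (cong (ℕ._* B) N≡))))
  where
  m = width (suc zero) q
  N≡ : N ≡ suc B
  N≡ = trans (sym B≡N) (+-comm B 1)
  n≡′ : m ℕ.* (4 ℕ.+ j) ≡ 2 ℕ.+ B
  n≡′ = trans n≡ (cong suc N≡)

claim : ∀ e q j (4≤k : 4 ≤ 4 ℕ.+ j) → Claim (width e q) (4 ℕ.+ j) 4≤k
claim zero       q j 4≤k = odd-claim q j 4≤k (firecracker-number zero q j)
claim (suc zero) q j 4≤k = even-claim q j 4≤k (firecracker-number (suc zero) q j)

theorem7 : (m k : ℕ) → 3 ≤ m → (4≤k : 4 ≤ k) →
    let M = + m
        K = + k
    in ∃[ h ] IsHamiltonianChromaticNumber (firecracker m k (≤-trans (s≤s (s≤s z≤n)) 4≤k)) h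
         × (¬ (2 ∣ m) → + h ≡ M ^ 2 * K ^ 2 - + 6 * M * (K - + 1) - (K * (M ^ 2 - + 1)) / + 2 + + 2)
         × (2 ∣ m → + h ≡ M ^ 2 * K ^ 2 - + 6 * M * (K - + 1) - (K * M ^ 2) / + 2 + + 2)
theorem7 _ _ (s≤s (s≤s (s≤s (z≤n {n})))) 4≤k@(s≤s (s≤s (s≤s (s≤s (z≤n {j}))))) = result (toWidth n)
  where
  result : ∀ {m} → Width m → Claim m (4 ℕ.+ j) 4≤k
  result (width-of e q) = claim e q j 4≤k
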